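{- Given is an unweighted directed graph with $m$ edges that has a directed spanning tree (DST). Without given root, no algorithm can enumerate such a DST with both preprocessing and delay in $o(m)$.
   Context: Graphs $G=(V,E)$ have vertex set $V=\{1,\dots,n\}$ and $m=|E|$ edges. An out-branching of a directed graph $G$ is an acyclic subgraph $B=(V,E')$ with $E'\subseteq E$ in which each vertex has in-degree at most $1$. A directed spanning tree (DST) is a weakly connected out-branching; it has $n-1$ edges and exactly one vertex of in-degree $0$, its root. Model: word RAM with word size in $\Omega(\log n)$. The graph is given by (out-)adjacency lists. The algorithm accesses the input by queries, each taking constant time: a degree query for a vertex $v$ returns the out-degree of $v$; a neighbor query for $v$ returns the next, not yet returned out-adjacency of $v$. The order of the entries in the lists is arbitrary. "Without given root" means that the input does not specify a vertex that is the root of some DST. Enumeration: given the whole input graph, an enumeration algorithm must, for some single DST $T$ of the graph, emit each edge of $T$ exactly once (irrevocably). Its delay is the worst-case maximum time the algorithm needs to emit the respective next edge; preprocessing time is additional time spent before emitting the first edge (so the first edge is emitted within the sum of the preprocessing and delay bounds). The lower bound is on worst-case complexity over all inputs. -}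

module Defs where

open import Data.Bool using (Bool; true; false; _∧_; _∨_; _xor_; not; if_then_else_)
open import Data.Fin using (Fin; toℕ; fromℕ<)
open import Data.List using (List; []; _∷_; _++_; length; map; head; drop; tabulate; [_])
open import Data.List.Membership.Propositional using (_∈_; _∉_)
open import Data.List.Relation.Unary.Linked using (Linked)
open import Data.List.Relation.Unary.Unique.Propositional using (Unique)
open import Data.Maybe using (Maybe; just; nothing; maybe′)
open import Data.Nat using (ℕ; zero; suc; _+_; _*_; _∸_; _^_; _≤_; _<ᵇ_; _≡ᵇ_; ⌊_/2⌋; NonZero)
open import Data.Nat.ListAction using (sum)
open import Data.Nat.DivMod using (_/_; _%_; _mod_)
open import Data.Nat.Properties using (_<?_; m^n≢0)
open import Data.Product using (∃-syntax; _×_; _,_; proj₁; proj₂)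
import Data.Vec.Functional as Vector
open Vector using (Vector; updateAt)
open import Function using (_∘_; const; _⇔_)
open import Level using (0ℓ)
open import Relation.Binary using (Rel; _⇒_)
open import Relation.Binary.Construct.Closure.Equivalence using (EqClosure)
open import Relation.Binary.Construct.Closure.Transitive using (TransClosure)
open import Relation.Binary.PropositionalEquality using (_≡_)
open import Relation.Nullary using (¬_; yes; no)

private variable
  k w n : ℕ

------------------------------------------------------------------------
-- Asymptotics

infix 4 _∈o_ _∈Ω_

-- For c ≥ 1 the constant c stands for ε = 1/c; the case c = 0 is vacuous.
_∈o_ : (ℕ → ℕ) → (ℕ → ℕ) → Set
f ∈o g = ∀ c → ∃[ x₀ ] (∀ x → x₀ ≤ x → c * f x ≤ g x)

_∈Ω_ : (ℕ → ℕ) → (ℕ → ℕ) → Set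
f ∈Ω g = ∃[ c ] ∃[ x₀ ] (∀ x → x₀ ≤ x → g x ≤ c * f x)

------------------------------------------------------------------------
-- Directed graphs and directed spanning trees

-- A digraph presented by its out-adjacency lists.  The order of the lists
-- is part of the presentation, so quantifying over presentations also
-- quantifies over all orders.
record Digraph (n : ℕ) : Set where
  field
    adj      : Fin n → List (Fin n)
    unique   : ∀ v → Unique (adj v)
    loopless : ∀ v → v ∉ adj v

  Edge : Rel (Fin n) 0ℓ
  Edge u v = v ∈ adj u

  outDegree : Fin n → ℕ
  outDegree v = length (adj v)

  size : ℕ
  size = sum (tabulate outDegree)

open Digraph public

-- A spanning subgraph is given by its edge relation T.
record IsOutBranching (G : Digraph n) (T : Rel (Fin n) 0ℓ) : Set where
  field
    subgraph   : T ⇒ Edge G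
    acyclic    : ∀ v → ¬ TransClosure T v v
    inDegree≤1 : ∀ {u u′ v} → T u v → T u′ v → u ≡ u′

record IsDST (G : Digraph n) (T : Rel (Fin n) 0ℓ) : Set where
  field
    isOutBranching  : IsOutBranching G T
    weaklyConnected : ∀ u v → EqClosure T u v

HasDST : Digraph n → Set₁
HasDST G = ∃[ T ] IsDST G T

------------------------------------------------------------------------
-- Word RAM programs

data Op : Set where
  add sub mul quo rem and or xor shl shr lt : Op

-- k is the number of registers.  Destination registers come first, and
-- jump targets are absolute.
data Instr (k : ℕ) : Set where
  literal    : Fin k → ℕ → Instr k
  arith      : Op → Fin k → Fin k → Fin k → Instr k
  load       : Fin k → Fin k → Instr k   -- r ← M[s]
  store      : Fin k → Fin k → Instr k   -- M[r] ← s
  jumpIfZero : Fin k → ℕ → Instr k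
  numVerts   : Fin k → Instr k           -- r ← n
  numEdges   : Fin k → Instr k           -- r ← m
  degree     : Fin k → Fin k → Instr k   -- r ← out-degree of the vertex s
  neighbor   : Fin k → Fin k → Instr k   -- r ← next out-neighbor of s, 0 if none is left
  emit       : Fin k → Fin k → Instr k   -- output the edge (r , s)

record Program : Set where
  field
    numRegs : ℕ
    code    : List (Instr numRegs)

open Program public

------------------------------------------------------------------------
-- Words

Word : ℕ → Set
Word w = Fin (2 ^ w)

word : ∀ w → ℕ → Word w
word w x = _mod_ x (2 ^ w) {{m^n≢0 2 w}}

fromBool : Bool → ℕ
fromBool b = if b then 1 else 0

odd : ℕ → Bool
odd x = not (x % 2 ≡ᵇ 0)

-- Acts on the w least significant bits.
bitwise : (Bool → Bool → Bool) → ℕ → ℕ → ℕ → ℕ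
bitwise f zero    x y = 0
bitwise f (suc w) x y =
  fromBool (f (odd x) (odd y)) + 2 * bitwise f w ⌊ x /2⌋ ⌊ y /2⌋

-- Results are reduced modulo 2 ^ w afterwards, so sub is subtraction
-- modulo 2 ^ w.  Division by zero yields 0.
evalℕ : Op → ℕ → ℕ → ℕ → ℕ
evalℕ add w x y       = x + y
evalℕ sub w x y       = x + (2 ^ w ∸ y)
evalℕ mul w x y       = x * y
evalℕ quo w x zero    = 0
evalℕ quo w x (suc y) = x / suc y
evalℕ rem w x zero    = 0
evalℕ rem w x (suc y) = x % suc y
evalℕ and w x y       = bitwise _∧_ w x y
evalℕ or  w x y       = bitwise _∨_ w x y
evalℕ xor w x y       = bitwise _xor_ w x y
evalℕ shl w x y       = x * 2 ^ y
evalℕ shr w x y       = _/_ x (2 ^ y) {{m^n≢0 2 y}}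
evalℕ lt  w x y       = fromBool (x <ᵇ y)

eval : ∀ w → Op → Word w → Word w → Word w
eval w o x y = word w (evalℕ o w (toℕ x) (toℕ y))

------------------------------------------------------------------------
-- Queries

-- Vertices are numbered 1, …, n on the machine; 0 is not a vertex.
name : Fin n → ℕ
name v = suc (toℕ v)

vertex : ∀ n → ℕ → Maybe (Fin n)
vertex n zero    = nothing
vertex n (suc i) with i <? n
... | yes i<n = just (fromℕ< i<n)
... | no  _   = nothing

nth : ∀ {A : Set} → ℕ → List A → Maybe A
nth i xs = head (drop i xs)

-- For each vertex, the number of neighbor queries made so far.
Cursors : ℕ → Set
Cursors n = Vector ℕ n

-- A query about a word that is not a vertex is answered by 0.
degreeQuery : Digraph n → ℕ → ℕ
degreeQuery {n} G x = maybe′ (outDegree G) 0 (vertex n x)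

neighborQuery : Digraph n → Cursors n → ℕ → ℕ × Cursors n
neighborQuery {n} G κ x = maybe′ answer (0 , κ) (vertex n x)
  where
  answer : Fin n → ℕ × Cursors n
  answer v = maybe′ name 0 (nth (κ v) (adj G v)) , updateAt κ v suc

------------------------------------------------------------------------
-- Execution: every instruction takes one unit of time

record Config (k w n : ℕ) : Set where
  constructor config
  field
    pc      : ℕ
    regs    : Vector (Word w) k
    mem     : Vector (Word w) (2 ^ w)
    cursors : Cursors n

open Config public

initial : Config k w n
initial {w = w} = config 0 (const (word w 0)) (const (word w 0)) (const 0)

advance : Config k w n → Config k w n
advance c = record c { pc = suc (pc c) }

set : Fin k → Word w → Config k w n → Config k w n
set r x c = record c { regs = updateAt (regs c) r (const x) }

exec : Digraph n → Instr k → Config k w n → Config k w n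
exec {w = w} G (literal r x) c = advance (set r (word w x) c)
exec {w = w} G (arith o r s t) c = advance (set r (eval w o (regs c s) (regs c t)) c)
exec G (load r s) c = advance (set r (mem c (regs c s)) c)
exec G (store r s) c =
  advance (record c { mem = updateAt (mem c) (regs c r) (const (regs c s)) })
exec G (jumpIfZero r p) c =
  if toℕ (regs c r) ≡ᵇ 0 then record c { pc = p } else advance c
exec {n = n} {w = w} G (numVerts r) c = advance (set r (word w n) c)
exec {w = w} G (numEdges r) c = advance (set r (word w (size G)) c)
exec {w = w} G (degree r s) c =
  advance (set r (word w (degreeQuery G (toℕ (regs c s)))) c)
exec {w = w} G (neighbor r s) c =
  let x , κ = neighborQuery G (cursors c) (toℕ (regs c s))
  in advance (set r (word w x) (record c { cursors = κ }))
exec G (emit r s) c = advance c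

-- The machine has halted once pc is outside the program.
step : (A : Program) → Digraph n → Config (numRegs A) w n → Config (numRegs A) w n
step A G c = maybe′ (λ i → exec G i c) c (nth (pc c) (code A))

run : ∀ w (A : Program) → Digraph n → ℕ → Config (numRegs A) w n
run w A G zero    = initial
run w A G (suc t) = step A G (run w A G t)

emitted : (A : Program) → Config (numRegs A) w n → Maybe (ℕ × ℕ)
emitted A c = maybe′ output nothing (nth (pc c) (code A))
  where
  output : Instr (numRegs A) → Maybe (ℕ × ℕ)
  output (emit r s) = just (toℕ (regs c r) , toℕ (regs c s))
  output _          = nothing

-- The output of the first t steps; each pair of words is paired with the
-- time at which it has been emitted.
trace : ∀ w (A : Program) → Digraph n → ℕ → List (ℕ × ℕ × ℕ)
trace w A G zero    = []
trace w A G (suc t) =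
  trace w A G t ++ maybe′ (λ e → [ suc t , e ]) [] (emitted A (run w A G t))

------------------------------------------------------------------------
-- Enumeration

-- With word size w, program A on input G outputs each edge of some DST
-- exactly once and nothing else, with preprocessing time p and delay d.
-- Halting is not required, only that the output is eventually complete.
record EnumeratesDST (w : ℕ) (A : Program) (G : Digraph n) (p d : ℕ) : Set₁ where
  field
    tree   : Rel (Fin n) 0ℓ
    isDST  : IsDST G tree
    events : List (ℕ × Fin n × Fin n)

  times : List ℕ
  times = map proj₁ events

  edges : List (Fin n × Fin n)
  edges = map proj₂ events

  field
    output   : ∃[ t₀ ] (∀ t → t₀ ≤ t →
                 trace w A G t ≡ map (λ (s , u , v) → s , name u , name v) events)
    once     : Unique edges
    complete : ∀ u v → (u , v) ∈ edges ⇔ tree u v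
    -- The first edge is emitted by time p + d, every further edge at most
    -- d after its predecessor.
    timely   : Linked (λ s t → t ≤ s + d) (p ∷ times)

{-# OPTIONS --safe #-}

-- Consider the star on 0, …, k + 1 in which the centre 0 is joined in both
-- directions to all vertices but z, and z has a single edge, to the entry v.
-- Since z has in-degree 0, a spanning tree contains (z , v) and no other edge
-- into v.  Run the algorithm on the star with root 1 and entry 0 until it
-- emits its first edge (u , v).  Each instruction looks at at most one of the
-- indices j that could tell this star from the star with root j + 2 and entry
-- v; m and all degrees are the same.  With o(m) instructions some j remains
-- unseen, so on that other star the algorithm also emits (u , v), although u
-- is not the root.
module Submission where

open import Defs
open import Data.Bool using (if_then_else_)
open import Data.Fin using (Fin; zero; suc; toℕ)
open import Data.Fin.Properties
  using (_≟_; toℕ-injective; injective⇒≤; ¬∀⟶∃¬; suc-injective; 0≢1+n)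
open import Data.List using (List; []; _∷_; length; tabulate; applyDownFrom)
open import Data.List.Membership.Propositional using (_∈_; _∉_)
open import Data.List.Membership.Propositional.Properties
  using (∈-tabulate⁺; ∈-tabulate⁻; ∈-++⁺ˡ; ∈-++⁺ʳ; ∈-++⁻; ∈-map⁺; ∈-map⁻)
import Data.List.Membership.Setoid.Properties as Membershipₛ
open import Data.List.Properties using (length-tabulate; length-applyDownFrom)
open import Data.List.Relation.Unary.All using ([])
open import Data.List.Relation.Unary.AllPairs using ([]; _∷_)
open import Data.List.Relation.Unary.Any using (here; there; index)
open import Data.List.Relation.Unary.Linked using (_∷_)
open import Data.List.Relation.Unary.Unique.Propositional using (Unique)
open import Data.List.Relation.Unary.Unique.Propositional.Properties using (tabulate⁺)
open import Data.Maybe using (Maybe; just; nothing)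
open import Data.Nat using (ℕ; zero; suc; _+_; _*_; _∸_; _≤_; _<_; z≤n; s≤s; NonZero; _⊔_)
import Data.Nat.Properties as ℕ
open import Data.List.Membership.DecPropositional ℕ._≟_ using (_∈?_)
open import Data.Nat.ListAction using (sum)
open import Data.Nat.Logarithm using (⌊log₂_⌋)
open import Data.Nat.Solver using (module +-*-Solver)
open import Data.Product using (∃-syntax; _×_; _,_; proj₁; proj₂)
open import Data.Sum using (inj₁; inj₂)
open import Function using (_∘_; const; Equivalence)
open import Level using (0ℓ)
open import Relation.Binary using (Rel)
open import Relation.Binary.Construct.Closure.Equivalence as Eq using (EqClosure)
open import Relation.Binary.Construct.Closure.ReflexiveTransitive using (ε; _◅_)
open import Relation.Binary.Construct.Closure.Symmetric using (fwd; bwd)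
open import Relation.Binary.Construct.Closure.Transitive using (TransClosure; [_]; _∷_)
open import Relation.Binary.PropositionalEquality
  using (_≡_; _≢_; refl; sym; trans; cong; cong₂; subst; setoid)
open import Relation.Nullary using (¬_; yes; no; contradiction)
open import Relation.Nullary.Decidable using (does; dec-true; dec-false)

private variable
  k w n : ℕ

-- Pigeonhole principle and facts about lists

-- If all of `Fin k` occurred in `xs`, positions would give an injection of `Fin k` into fewer than
-- `k` places. Entries are in ℕ since cursors may exceed `k`.
fresh : (xs : List ℕ) → length xs < k → ∃[ j ] toℕ {k} j ∉ xs
fresh {k} xs ∣xs∣<k = ¬∀⟶∃¬ k _ (λ j → toℕ j ∈? xs) λ all∈ →
  ℕ.<⇒≱ ∣xs∣<k (injective⇒≤ {f = index ∘ all∈} λ {i} {j} eq →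
    toℕ-injective (Membershipₛ.index-injective (setoid ℕ) (all∈ i) (all∈ j) eq))

sum-tabulate-1 : ∀ n → sum (tabulate {n = n} (const 1)) ≡ n
sum-tabulate-1 zero    = refl
sum-tabulate-1 (suc n) = cong suc (sum-tabulate-1 n)

nth-tabulate-cong : ∀ {A : Set} {f g : Fin n → A} i →
  (∀ j → toℕ j ≡ i → f j ≡ g j) → nth i (tabulate f) ≡ nth i (tabulate g)
nth-tabulate-cong {zero}  zero    f≗g = refl
nth-tabulate-cong {zero}  (suc i) f≗g = refl
nth-tabulate-cong {suc n} zero    f≗g = cong just (f≗g zero refl)
nth-tabulate-cong {suc n} (suc i) f≗g =
  nth-tabulate-cong i (λ j eq → f≗g (suc j) (cong suc eq))

name-injective : {u v : Fin n} → name u ≡ name v → u ≡ v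
name-injective = toℕ-injective ∘ ℕ.suc-injective

-- Construction of the stars

-- The i-th out-neighbor of the centre is i + 2, except that the root z is
-- replaced by 1.  So i tells nothing about z unless z = i + 2.
spoke : Fin (2 + k) → Fin k → Fin (2 + k)
spoke z i = if does (suc (suc i) ≟ z) then suc zero else suc (suc i)

spoke-≢ : ∀ {z} {i : Fin k} → suc (suc i) ≢ z → spoke z i ≡ suc (suc i)
spoke-≢ {z = z} {i} i≢z rewrite dec-false (suc (suc i) ≟ z) i≢z = refl

spoke-≡ : ∀ (i : Fin k) → spoke (suc (suc i)) i ≡ suc zero
spoke-≡ i rewrite dec-true (suc (suc i) ≟ suc (suc i)) refl = refl

0≢spoke : ∀ z (i : Fin k) → zero ≢ spoke z i
0≢spoke z i with suc (suc i) ≟ z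
... | yes _ = λ ()
... | no  _ = λ ()

root≢spoke : ∀ z (i : Fin k) → z ≢ spoke z i
root≢spoke z i eq with suc (suc i) ≟ z
root≢spoke z i refl | yes ()
... | no i≢z = i≢z (sym eq)

spoke-injective : ∀ z {i j : Fin k} → spoke z i ≡ spoke z j → i ≡ j
spoke-injective z {i} {j} eq with suc (suc i) ≟ z | suc (suc j) ≟ z
... | yes i≡z | yes j≡z = suc-injective (suc-injective (trans i≡z (sym j≡z)))
... | no  _   | no  _   = suc-injective (suc-injective eq)
spoke-injective z () | yes _ | no _
spoke-injective z () | no _  | yes _

spoke-surjective : ∀ {z x : Fin (2 + k)} → z ≢ zero → x ≢ zero → x ≢ z → ∃[ i ] x ≡ spoke z i
spoke-surjective {x = zero}         z≢0 x≢0 x≢z = contradiction refl x≢0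
spoke-surjective {x = suc (suc i)}  z≢0 x≢0 x≢z = i , sym (spoke-≢ x≢z)
spoke-surjective {z = zero}        {suc zero} z≢0 x≢0 x≢z = contradiction refl z≢0
spoke-surjective {z = suc zero}    {suc zero} z≢0 x≢0 x≢z = contradiction refl x≢z
spoke-surjective {z = suc (suc i)} {suc zero} z≢0 x≢0 x≢z = i , sym (spoke-≡ i)

star : (z v : Fin (2 + k)) → v ≢ z → Digraph (2 + k)
star {k} z v v≢z = record { adj = out ; unique = out-unique ; loopless = out-loopless }
  where
  out : Fin (2 + k) → List (Fin (2 + k))
  out zero    = tabulate (spoke z)
  out (suc i) = (if does (suc i ≟ z) then v else zero) ∷ []

  out-unique : ∀ x → Unique (out x)
  out-unique zero    = tabulate⁺ (spoke-injective z)
  out-unique (suc i) = [] ∷ []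

  out-loopless : ∀ x → x ∉ out x
  out-loopless zero    x∈ = let i , eq = ∈-tabulate⁻ x∈ in 0≢spoke z i eq
  out-loopless (suc i) (here eq) with suc i ≟ z
  ... | yes i≡z = v≢z (trans (sym eq) i≡z)
  out-loopless (suc i) (here ()) | no _

-- Root 1 displaces no entry of the centre's list, and entry 0 gives vertex 1 the list of an
-- ordinary leaf. So a star with root j + 2 can differ from this one only at position j of the
-- centre's list and in the list of j + 2.
star₁ : ∀ k → Digraph (2 + k)
star₁ k = star (suc zero) zero 0≢1+n

adj-root : ∀ {z v : Fin (2 + k)} (v≢z : v ≢ z) → z ≢ zero → adj (star z v v≢z) z ≡ v ∷ []
adj-root {z = zero}  v≢z z≢0 = contradiction refl z≢0
adj-root {z = suc i} v≢z z≢0 rewrite dec-true (i ≟ i) refl = refl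

adj-leaf : ∀ {z v x : Fin (2 + k)} (v≢z : v ≢ z) → x ≢ zero → x ≢ z → adj (star z v v≢z) x ≡ zero ∷ []
adj-leaf {x = zero}          v≢z x≢0 x≢z = contradiction refl x≢0
adj-leaf {z = z} {x = suc i} v≢z x≢0 x≢z rewrite dec-false (suc i ≟ z) x≢z = refl

-- Size, degrees and spanning trees of a star

module _ {z v : Fin (2 + k)} (v≢z : v ≢ z) where

  private G = star z v v≢z

  size-star : size G ≡ k + suc k
  size-star = cong₂ _+_ (length-tabulate (spoke z)) (sum-tabulate-1 (suc k))

  outDegree-star : ∀ x → outDegree G x ≡ outDegree (star₁ k) x
  outDegree-star zero    = trans (length-tabulate (spoke z)) (sym (length-tabulate (spoke (suc zero))))
  outDegree-star (suc i) = refl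

  module _ (z≢0 : z ≢ zero) where

    root-edge : ∀ {x} → Edge G z x → x ≡ v
    root-edge e with here eq ← subst (_ ∈_) (adj-root v≢z z≢0) e = eq

    root-inDegree-0 : ∀ {x} → ¬ Edge G x z
    root-inDegree-0 {zero}  e = let i , eq = ∈-tabulate⁻ e in root≢spoke z i eq
    root-inDegree-0 {suc i} (here eq) with suc i ≟ z
    ... | yes _ = v≢z (sym eq)
    ... | no  _ = z≢0 eq

    module _ {T} (dst : IsDST G T) where
      open IsDST dst
      open IsOutBranching isOutBranching

      -- A walk from `z` to `v` is nonempty, and its first step cannot run backwards along an edge
      -- into `z`, so it uses the only edge out of `z`.
      root-edge∈DST : T z v
      root-edge∈DST with weaklyConnected z v
      ... | ε         = contradiction refl v≢z
      ... | fwd e ◅ _ = subst (T z) (root-edge (subgraph e)) e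
      ... | _◅_ {j = x} (bwd e) _ = contradiction (subgraph e) (root-inDegree-0 {x})

      entry-parent : ∀ {u} → T u v → u ≡ z
      entry-parent e = inDegree≤1 e root-edge∈DST

    -- The path from `z` over `v` to the centre, with all other vertices below the centre. The guard
    -- of `centre` avoids a loop when the entry is the centre itself.
    data Tree : Rel (Fin (2 + k)) 0ℓ where
      enter  : Tree z v
      centre : v ≢ zero → Tree v zero
      leaf   : ∀ {x} → x ≢ zero → x ≢ v → x ≢ z → Tree zero x

    -- A rank function that certifies acyclicity. It is not always the distance from `z`: leaves get
    -- 3 even if the entry is the centre.
    depth : Fin (2 + k) → ℕ
    depth x = if does (x ≟ z) then 0 else if does (x ≟ v) then 1 else
              if does (x ≟ zero) then 2 else 3

    depth-zero : depth zero ≤ 2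
    depth-zero with zero ≟ z | zero ≟ v
    ... | yes _ | _     = z≤n
    ... | no  _ | yes _ = s≤s z≤n
    ... | no  _ | no  _ = ℕ.≤-refl

    depth-mono : ∀ {u x} → Tree u x → depth u < depth x
    depth-mono enter
      rewrite dec-true (z ≟ z) refl | dec-false (v ≟ z) v≢z | dec-true (v ≟ v) refl = s≤s z≤n
    depth-mono (centre v≢0)
      rewrite dec-false (v ≟ z) v≢z | dec-true (v ≟ v) refl
            | dec-false (zero ≟ z) (z≢0 ∘ sym) | dec-false (zero ≟ v) (v≢0 ∘ sym) = ℕ.≤-refl
    depth-mono (leaf {x} x≢0 x≢v x≢z)
      rewrite dec-false (x ≟ z) x≢z | dec-false (x ≟ v) x≢v | dec-false (x ≟ zero) x≢0 = s≤s depth-zero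

    depth-mono⁺ : ∀ {u x} → TransClosure Tree u x → depth u < depth x
    depth-mono⁺ [ e ]    = depth-mono e
    depth-mono⁺ (e ∷ es) = ℕ.<-trans (depth-mono e) (depth-mono⁺ es)

    Tree-subgraph : ∀ {u x} → Tree u x → Edge G u x
    Tree-subgraph enter        = subst (v ∈_) (sym (adj-root v≢z z≢0)) (here refl)
    Tree-subgraph (centre v≢0) = subst (zero ∈_) (sym (adj-leaf v≢z v≢0 v≢z)) (here refl)
    Tree-subgraph (leaf x≢0 _ x≢z) with i , refl ← spoke-surjective z≢0 x≢0 x≢z = ∈-tabulate⁺ i

    Tree-inDegree≤1 : ∀ {u u′ x} → Tree u x → Tree u′ x → u ≡ u′
    Tree-inDegree≤1 enter          enter          = refl
    Tree-inDegree≤1 enter          (centre v≢0)   = contradiction refl v≢0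
    Tree-inDegree≤1 enter          (leaf _ v≢v _) = contradiction refl v≢v
    Tree-inDegree≤1 (centre v≢0)   enter          = contradiction refl v≢0
    Tree-inDegree≤1 (centre _)     (centre _)     = refl
    Tree-inDegree≤1 (centre _)     (leaf 0≢0 _ _) = contradiction refl 0≢0
    Tree-inDegree≤1 (leaf _ v≢v _) enter          = contradiction refl v≢v
    Tree-inDegree≤1 (leaf 0≢0 _ _) (centre _)     = contradiction refl 0≢0
    Tree-inDegree≤1 (leaf _ _ _)   (leaf _ _ _)   = refl

    z~v : EqClosure Tree z v
    z~v = Eq.return enter

    z~0 : EqClosure Tree z zero
    z~0 with v ≟ zero
    ... | yes v≡0 = subst (EqClosure Tree z) v≡0 z~v
    ... | no  v≢0 = Eq.transitive Tree z~v (Eq.return (centre v≢0))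

    z~ : ∀ x → EqClosure Tree z x
    z~ x with x ≟ z | x ≟ v | x ≟ zero
    ... | yes refl | _        | _        = ε
    ... | no  _    | yes refl | _        = z~v
    ... | no  _    | no  _    | yes refl = z~0
    ... | no  x≢z  | no  x≢v  | no  x≢0  =
      Eq.transitive Tree z~0 (Eq.return (leaf x≢0 x≢v x≢z))

    hasDST : HasDST G
    hasDST = Tree , record
      { isOutBranching = record
        { subgraph   = Tree-subgraph
        ; acyclic    = λ x c → ℕ.<-irrefl refl (depth-mono⁺ c)
        ; inDegree≤1 = Tree-inDegree≤1
        }
      ; weaklyConnected = λ x y → Eq.transitive Tree (Eq.symmetric Tree (z~ x)) (z~ y)
      }

-- Indistinguishability of the stars

-- Where an instruction sees no index, the junk value 0 merely excludes one
-- more candidate.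
indexSeenAt : Maybe (Fin (2 + k)) → Cursors (2 + k) → ℕ
indexSeenAt nothing              κ = 0
indexSeenAt (just zero)          κ = κ zero
indexSeenAt (just (suc zero))    κ = 0
indexSeenAt (just (suc (suc j))) κ = toℕ j

seenIndex : ∀ {r} → Maybe (Instr r) → Config r w (2 + k) → ℕ
seenIndex {k = k} (just (neighbor r s)) c = indexSeenAt (vertex (2 + k) (toℕ (regs c s))) (cursors c)
seenIndex         _                     c = 0

-- Recorded on the run on `star₁` only, hence independent of j, which can thus be chosen after the
-- run.
seen : ∀ k w (A : Program) → ℕ → ℕ
seen k w A t = let c = run w A (star₁ k) t in seenIndex (nth (pc c) (code A)) c

module _ (j : Fin k) {v : Fin (2 + k)} (v≢z : v ≢ suc (suc j)) where

  private
    H G : Digraph (2 + k)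
    H = star₁ k
    G = star (suc (suc j)) v v≢z

  degreeQuery-star : ∀ x → degreeQuery G x ≡ degreeQuery H x
  degreeQuery-star x with vertex (2 + k) x
  ... | nothing = refl
  ... | just y  = outDegree-star v≢z y

  neighborQuery-star : ∀ κ x → toℕ j ≢ indexSeenAt (vertex (2 + k) x) κ →
    neighborQuery G κ x ≡ neighborQuery H κ x
  neighborQuery-star κ x j≢ with vertex (2 + k) x
  ... | nothing = refl
  ... | just zero
    rewrite nth-tabulate-cong {f = spoke (suc (suc j))} {spoke (suc zero)} (κ zero)
      (λ i i≡κ → spoke-≢ {i = i} λ eq → j≢ (trans (cong toℕ (sym (suc-injective (suc-injective eq)))) i≡κ)) = refl
  -- Vertex 1 is the root of `H` and a leaf of `G`, but its only out-neighbor is 0 in both.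
  ... | just (suc zero) = refl
  ... | just (suc (suc i))
    rewrite dec-false (i ≟ j) (λ eq → j≢ (cong toℕ (sym eq))) = refl

  size-star-≡ : size G ≡ size H
  size-star-≡ = trans (size-star v≢z) (sym (size-star {k} {suc zero} {zero} 0≢1+n))

  exec-star : ∀ {r} (i : Instr r) (c : Config r w (2 + k)) →
    toℕ j ≢ seenIndex (just i) c → exec G i c ≡ exec H i c
  exec-star (literal _ _)    c j≢ = refl
  exec-star (arith _ _ _ _)  c j≢ = refl
  exec-star (load _ _)       c j≢ = refl
  exec-star (store _ _)      c j≢ = refl
  exec-star (jumpIfZero _ _) c j≢ = refl
  exec-star (numVerts _)     c j≢ = refl
  exec-star {w} (numEdges r) c j≢ = cong (λ m → advance (set r (word w m) c)) size-star-≡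
  exec-star {w} (degree r s) c j≢ =
    cong (λ x → advance (set r (word w x) c)) (degreeQuery-star (toℕ (regs c s)))
  exec-star {w} (neighbor r s) c j≢ =
    cong (λ (x , κ) → advance (set r (word w x) (record c { cursors = κ })))
      (neighborQuery-star (cursors c) (toℕ (regs c s)) j≢)
  exec-star (emit _ _)       c j≢ = refl

  step-star : ∀ A (c : Config (numRegs A) w (2 + k)) →
    toℕ j ≢ seenIndex (nth (pc c) (code A)) c → step A G c ≡ step A H c
  step-star A c j≢ with nth (pc c) (code A)
  ... | nothing = refl
  ... | just i  = exec-star i c j≢

  run-star : ∀ w A t → toℕ j ∉ applyDownFrom (seen k w A) t → run w A G t ≡ run w A H t
  run-star w A zero    j∉ = refl
  run-star w A (suc t) j∉ =
    trans (cong (step A G) (run-star w A t (j∉ ∘ there))) (step-star A (run w A H t) (j∉ ∘ here))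

-- Traces and emitted edges

module _ (w : ℕ) (A : Program) (G : Digraph n) where

  -- The stamp counts the emitting step itself, so it is one more than the number of steps before
  -- the emission.
  ∈-trace⁻ : ∀ {s e} t → (s , e) ∈ trace w A G t →
    ∃[ s′ ] s ≡ suc s′ × emitted A (run w A G s′) ≡ just e
  ∈-trace⁻ (suc t) s∈ with ∈-++⁻ (trace w A G t) s∈
  ... | inj₁ s∈ = ∈-trace⁻ t s∈
  ... | inj₂ s∈ with emitted A (run w A G t) in eq
  ∈-trace⁻ (suc t) _ | inj₂ (here refl) | just e = t , refl , eq

  ∈-trace⁺ : ∀ {s e} t → s < t → emitted A (run w A G s) ≡ just e → (suc s , e) ∈ trace w A G t
  ∈-trace⁺ (suc t) (s≤s s≤t) eq with ℕ.m≤n⇒m<n∨m≡n s≤t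
  ... | inj₁ s<t = ∈-++⁺ˡ (∈-trace⁺ t s<t eq)
  ... | inj₂ refl rewrite eq = ∈-++⁺ʳ (trace w A G t) (here refl)

module _ {w A} {G : Digraph n} {p d} (E : EnumeratesDST w A G p d) where
  open EnumeratesDST E

  -- The edge from `x` to `y` only ensures that there is an event; the first edge emitted may be
  -- another one.
  first-emission : ∀ {x y} → tree x y →
    ∃[ s ] ∃[ u ] ∃[ v ] suc s ≤ p + d × emitted A (run w A G s) ≡ just (name u , name v)
  first-emission {x} {y} xy with events | output | timely | Equivalence.from (complete x y) xy
  ... | (s , u , v) ∷ es | t₀ , out | s≤p+d ∷ _ | _
    with s′ , refl , eq ← ∈-trace⁻ w A G t₀ (subst ((s , name u , name v) ∈_) (sym (out t₀ ℕ.≤-refl)) (here refl))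
    = s′ , u , v , s≤p+d , eq

  emitted⇒tree : ∀ {s u v} → emitted A (run w A G s) ≡ just (name u , name v) → tree u v
  emitted⇒tree {s} {u} {v} eq = from-event (∈-map⁻ _ (subst ((suc s , name u , name v) ∈_)
      -- Late enough for the output to be complete and for the emission after `s` steps to be in the
      -- trace.
      (proj₂ output (proj₁ output ⊔ suc s) (ℕ.m≤m⊔n _ _))
      (∈-trace⁺ w A G (proj₁ output ⊔ suc s) (ℕ.m≤n⊔m (proj₁ output) _) eq)))
    where
    from-event : ∃[ e ] (e ∈ events × (suc s , name u , name v) ≡
      (proj₁ e , name (proj₁ (proj₂ e)) , name (proj₂ (proj₂ e)))) → tree u v
    from-event ((_ , u′ , v′) , e∈ , eq)
      with refl ← name-injective {u = u} {u′} (cong (proj₁ ∘ proj₂) eq)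
         | refl ← name-injective {u = v} {v′} (cong (proj₂ ∘ proj₂) eq)
      = Equivalence.to (complete u v) (∈-map⁺ proj₂ e∈)

-- Step count and choice of the second star

-- The constants 8 and 5 are chosen so that 8(s + 2) ≤ 4k + 18 ≤ 8k.
few-steps : ∀ {s} p d k → 5 ≤ k → s ≤ p + d → 8 * p ≤ k + suc k → 8 * d ≤ k + suc k → 2 + s ≤ k
few-steps {s} p d k 5≤k s≤p+d 8p≤m 8d≤m = ℕ.*-cancelˡ-≤ 8 (begin
  8 * (2 + s)                               ≤⟨ ℕ.*-monoʳ-≤ 8 (ℕ.+-monoʳ-≤ 2 s≤p+d) ⟩
  8 * (2 + (p + d))                         ≡⟨ solve 2 (λ p d → con 8 :* (con 2 :+ (p :+ d)) :=
                                                con 16 :+ (con 8 :* p :+ con 8 :* d)) refl p d ⟩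
  16 + (8 * p + 8 * d)                      ≤⟨ ℕ.+-monoʳ-≤ 16 (ℕ.+-mono-≤ 8p≤m 8d≤m) ⟩
  16 + (k + suc k + (k + suc k))            ≤⟨ ℕ.m≤n+m _ 2 ⟩
  18 + (k + suc k + (k + suc k))            ≡⟨ solve 1 (λ k →
                                                con 18 :+ (k :+ (con 1 :+ k) :+ (k :+ (con 1 :+ k))) :=
                                                con 4 :* con 5 :+ con 4 :* k) refl k ⟩
  4 * 5 + 4 * k                             ≤⟨ ℕ.+-monoˡ-≤ (4 * k) (ℕ.*-monoʳ-≤ 4 5≤k) ⟩
  4 * k + 4 * k                             ≡⟨ solve 1 (λ k → con 4 :* k :+ con 4 :* k := con 8 :* k) refl k ⟩
  8 * k                                     ∎)
  where
  open ℕ.≤-Reasoning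
  open +-*-Solver

theorem11 : (w : ℕ → ℕ) → w ∈Ω ⌊log₂_⌋ →
    ¬ (∃[ A ] ∃[ p ] ∃[ d ] (p ∈o (λ m → m)) × (d ∈o (λ m → m)) ×
    (∀ n .{{_ : NonZero n}} (G : Digraph n) → HasDST G →
    EnumeratesDST (w n) A G (p (size G)) (d (size G))))
theorem11 w _ (A , p , d , p∈o , d∈o , enumerates) =
  let s , u , v , s<p+d , emits = first-emission E₁ (root-edge∈DST 0≢1+n (λ ()) isDST₁)
      -- The new root j + 2 must be neither `u` nor `v`, and j must be unseen. For vertices 0 and 1
      -- truncation merely excludes index 0 as well.
      seen-or-uv = toℕ u ∸ 2 ∷ toℕ v ∸ 2 ∷ applyDownFrom (seen K (w N) A) s
      j , j∉ = fresh {K} seen-or-uv (subst (_< K) (cong (2 +_) (sym (length-applyDownFrom _ s)))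
                 -- Used for `suc s` steps, which gives the strict inequality 2 + s < K.
                 (few-steps (p (size H)) (d (size H)) K (ℕ.m≤m+n 5 _) s<p+d
                   (small p (proj₂ (p∈o 8)) (ℕ.m≤m+n x₀ x₁))
                   (small d (proj₂ (d∈o 8)) (ℕ.m≤n+m x₁ x₀))))
      v≢z : v ≢ suc (suc j)
      v≢z v≡z = j∉ (there (here (cong (λ x → toℕ x ∸ 2) (sym v≡z))))
      E₂ = enumerates N (star (suc (suc j)) v v≢z) (hasDST v≢z (λ ()))
      open EnumeratesDST E₂ using () renaming (isDST to isDST₂)
      -- Both runs are in the same configuration after `s` steps, so the same edge is emitted on the
      -- second star, where `v` is the entry.
      uv∈T = emitted⇒tree E₂ {s} (trans (cong (emitted A)
               (run-star j v≢z (w N) A s (λ j∈ → j∉ (there (there j∈))))) emits)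
      u≡z = entry-parent v≢z (λ ()) isDST₂ uv∈T
  in j∉ (here (cong (λ x → toℕ x ∸ 2) (sym u≡z)))
  where
  x₀ = proj₁ (p∈o 8)
  x₁ = proj₁ (d∈o 8)
  -- At least 5 for `few-steps`, and large enough that the size of `H` passes both thresholds for
  -- the factor 8.
  K = 5 + (x₀ + x₁)
  N = 2 + K

  H : Digraph N
  H = star₁ K

  size-H : size H ≡ K + suc K
  size-H = size-star {K} {suc zero} {zero} 0≢1+n

  E₁ = enumerates N H (hasDST 0≢1+n (λ ()))
  open EnumeratesDST E₁ using () renaming (isDST to isDST₁)

  small : ∀ {x} f → (∀ y → x ≤ y → 8 * f y ≤ y) → x ≤ x₀ + x₁ → 8 * f (size H) ≤ K + suc K
  small {x} f f-small x≤ = subst (8 * f (size H) ≤_) size-H (f-small (size H)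
    (subst (x ≤_) (sym size-H) (ℕ.≤-trans x≤ (ℕ.≤-trans (ℕ.m≤n+m (x₀ + x₁) 5) (ℕ.m≤m+n K (suc K))))))
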